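{- Let $\gamma \geq 0$ be an integer and let $\mathcal{P}$ be a $\gamma$-pluriassociative algebra admitting a $b$-wire-unit $e$ for some $b \in [\gamma]$. Then: (i) for all $a \in [b]$, the operations $\dashv_a$, $\dashv_b$, $\vdash_a$, and $\vdash_b$ of $\mathcal{P}$ are equal; (ii) $e$ is also an $a$-wire-unit for all $a \in [b]$; (iii) $e$ is the only wire-unit of $\mathcal{P}$; (iv) if $e'$ is an $a$-bar-unit for some $a \in [b]$, then $e' = e$.
   Context: The ground field has characteristic zero; $[n] = \{1, \dots, n\}$. A $\gamma$-pluriassociative algebra is a vector space with binary linear operations $\dashv_a, \vdash_a$, $a \in [\gamma]$, satisfying for all elements $x, y, z$ and all $a, a' \in [\gamma]$ (with $a \uparrow a' := \max(a, a')$): $(x \vdash_{a'} y) \dashv_a z = x \vdash_{a'} (y \dashv_a z)$; $(x \dashv_{a \uparrow a'} y) \dashv_a z = x \dashv_a (y \vdash_{a'} z)$; $(x \dashv_{a'} y) \vdash_a z = x \vdash_a (y \vdash_{a \uparrow a'} z)$; $(x \dashv_a y) \dashv_{a \uparrow a'} z = x \dashv_a (y \dashv_{a'} z)$; $(x \vdash_{a'} y) \vdash_a z = x \vdash_{a \uparrow a'} (y \vdash_a z)$. For $a \in [\gamma]$, an element $e$ of $\mathcal{P}$ is an $a$-wire-unit if $e \dashv_a x = x = x \vdash_a e$ for all $x \in \mathcal{P}$; it is a wire-unit if it is an $a$-wire-unit for some $a \in [\gamma]$. An element $e$ is an $a$-bar-unit if $x \dashv_a e = x = e \vdash_a x$ for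 all $x \in \mathcal{P}$. -}

module Defs where

open import Level using (Level; suc; _⊔_)
open import Algebra.Core using (Op₂)
open import Algebra.Bundles using (CommutativeRing)
open import Algebra.Apartness.Bundles using (HeytingField; HeytingCommutativeRing)
open import Algebra.Module.Bundles using (Module)
import Algebra.Module.Morphism.Structures as Morphism
import Algebra.Definitions.RawMonoid as RawMonoidDefs
import Algebra.Construct.NaturalChoice.Max as Max
open import Data.Nat.Base using (ℕ)
open import Data.Fin.Base using (Fin)
import Data.Fin.Properties as Fin
open import Data.Product.Base using (_×_; ∃-syntax)
open import Relation.Binary.PropositionalEquality.Core using (_≡_)

private
  variable
    k ℓ₁ ℓ₂ m ℓm : Level

scalars : HeytingField k ℓ₁ ℓ₂ → CommutativeRing k ℓ₁
scalars K = HeytingCommutativeRing.commutativeRing (HeytingField.heytingCommutativeRing K)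

-- Implies in particular that 1# is not equal to 0#, which HeytingField itself
-- does not require.
CharacteristicZero : HeytingField k ℓ₁ ℓ₂ → Set ℓ₁
CharacteristicZero K = ∀ (n : ℕ) → n · 1# ≈ 0# → n ≡ 0
  where
  open CommutativeRing (scalars K)
  open RawMonoidDefs +-rawMonoid using () renaming (_×_ to _·_)

VectorSpace : HeytingField k ℓ₁ ℓ₂ → (m ℓm : Level) → Set (k ⊔ ℓ₁ ⊔ suc (m ⊔ ℓm))
VectorSpace K = Module (scalars K)

module _ {K : HeytingField k ℓ₁ ℓ₂} (V : VectorSpace K m ℓm) where

  open Module V
  open Morphism.ModuleMorphisms rawModule rawModule using (IsModuleHomomorphism)

  -- The homomorphism structure includes compatibility with _≈ᴹ_, so a bilinear
  -- operation is a congruence in each argument.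
  IsBilinear : Op₂ Carrierᴹ → Set (k ⊔ m ⊔ ℓm)
  IsBilinear _∙_ = (∀ x → IsModuleHomomorphism (λ y → x ∙ y))
                 × (∀ y → IsModuleHomomorphism (λ x → x ∙ y))

-- [γ] = {1, …, γ} is represented by Fin γ with its order: only the order and
-- the maximum of indices matter.
infixl 6 _↑_

_↑_ : {γ : ℕ} → Op₂ (Fin γ)
_↑_ {γ} = Max._⊔_ (Fin.≤-totalOrder γ)

record PluriassociativeAlgebra (K : HeytingField k ℓ₁ ℓ₂) (γ : ℕ) (m ℓm : Level)
       : Set (k ⊔ ℓ₁ ⊔ suc (m ⊔ ℓm)) where

  infix 7 _⊣[_]_ _⊢[_]_

  field
    vectorSpace : VectorSpace K m ℓm

  open Module vectorSpace public

  field
    _⊣[_]_ : Carrierᴹ → Fin γ → Carrierᴹ → Carrierᴹ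
    _⊢[_]_ : Carrierᴹ → Fin γ → Carrierᴹ → Carrierᴹ

    ⊣-bilinear : ∀ a → IsBilinear {K = K} vectorSpace (_⊣[ a ]_)
    ⊢-bilinear : ∀ a → IsBilinear {K = K} vectorSpace (_⊢[ a ]_)

    ⊢-⊣-assoc : ∀ a a′ x y z →
      (x ⊢[ a′ ] y) ⊣[ a ] z ≈ᴹ x ⊢[ a′ ] (y ⊣[ a ] z)
    ⊣-inner-⊢ : ∀ a a′ x y z →
      (x ⊣[ a ↑ a′ ] y) ⊣[ a ] z ≈ᴹ x ⊣[ a ] (y ⊢[ a′ ] z)
    ⊢-inner-⊣ : ∀ a a′ x y z →
      (x ⊣[ a′ ] y) ⊢[ a ] z ≈ᴹ x ⊢[ a ] (y ⊢[ a ↑ a′ ] z)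
    ⊣-assoc : ∀ a a′ x y z →
      (x ⊣[ a ] y) ⊣[ a ↑ a′ ] z ≈ᴹ x ⊣[ a ] (y ⊣[ a′ ] z)
    ⊢-assoc : ∀ a a′ x y z →
      (x ⊢[ a′ ] y) ⊢[ a ] z ≈ᴹ x ⊢[ a ↑ a′ ] (y ⊢[ a ] z)

  infix 4 _≐_

  _≐_ : Op₂ Carrierᴹ → Op₂ Carrierᴹ → Set (m ⊔ ℓm)
  _∙_ ≐ _∘_ = ∀ x y → (x ∙ y) ≈ᴹ (x ∘ y)

  IsWireUnitAt : Fin γ → Carrierᴹ → Set (m ⊔ ℓm)
  IsWireUnitAt a e = ∀ x → (e ⊣[ a ] x ≈ᴹ x) × (x ≈ᴹ x ⊢[ a ] e)

  IsWireUnit : Carrierᴹ → Set (m ⊔ ℓm)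
  IsWireUnit e = ∃[ a ] IsWireUnitAt a e

  IsBarUnitAt : Fin γ → Carrierᴹ → Set (m ⊔ ℓm)
  IsBarUnitAt a e = ∀ x → (x ⊣[ a ] e ≈ᴹ x) × (x ≈ᴹ e ⊢[ a ] x)

{-# OPTIONS --safe #-}
-- Substituting the b-wire-unit e on the outer left of the axiom ⊣-inner-⊢ turns it
-- into y ⊣_b z = y ⊢_a z for a ≤ b, and dually e on the outer right of ⊢-inner-⊣
-- gives x ⊣_a y = x ⊢_b y; these identities yield everything else.  Two wire-units
-- are compared at the smaller of their levels, where both are units for ⊣ = ⊢.
module Submission where

open import Defs
open import Level using (Level)
open import Algebra.Apartness.Bundles using (HeytingField)
open import Algebra.Module.Morphism.Structures using (module ModuleMorphisms)
open import Data.Nat.Base using (ℕ)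
open import Data.Fin.Base using (Fin; _≤_)
open import Data.Fin.Properties using (≤-refl; ≤-total; ≤-totalOrder)
open import Data.Product.Base using (_×_; _,_; proj₁; proj₂)
open import Data.Sum.Base using (inj₁; inj₂)
open import Relation.Binary.PropositionalEquality.Core using (_≡_; subst)
import Algebra.Construct.NaturalChoice.Max as Max
import Relation.Binary.Reasoning.Setoid as SetoidReasoning

↑-absorbʳ : ∀ {γ} {a b : Fin γ} → a ≤ b → b ↑ a ≡ b
↑-absorbʳ {γ} = Max.x≤y⇒y⊔x≈y (≤-totalOrder γ)

module _ {k ℓ₁ ℓ₂ m ℓm : Level} {K : HeytingField k ℓ₁ ℓ₂} {γ : ℕ}
         (P : PluriassociativeAlgebra K γ m ℓm) where

  open PluriassociativeAlgebra P
  open ModuleMorphisms rawModule rawModule using (module IsModuleHomomorphism)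
  open SetoidReasoning ≈ᴹ-setoid

  ⊣-congʳ : ∀ a {x y} z → x ≈ᴹ y → x ⊣[ a ] z ≈ᴹ y ⊣[ a ] z
  ⊣-congʳ a z = IsModuleHomomorphism.⟦⟧-cong (proj₂ (⊣-bilinear a) z)

  ⊢-congˡ : ∀ a x {y z} → y ≈ᴹ z → x ⊢[ a ] y ≈ᴹ x ⊢[ a ] z
  ⊢-congˡ a x = IsModuleHomomorphism.⟦⟧-cong (proj₁ (⊢-bilinear a) x)

  module _ {b e} (wire : IsWireUnitAt b e) where

    private
      e⊣x≈x : ∀ x → e ⊣[ b ] x ≈ᴹ x
      e⊣x≈x x = proj₁ (wire x)

      x⊢e≈x : ∀ x → x ⊢[ b ] e ≈ᴹ x
      x⊢e≈x x = ≈ᴹ-sym (proj₂ (wire x))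

    ⊣≐⊢-lower : ∀ {a} → a ≤ b → _⊣[ b ]_ ≐ _⊢[ a ]_
    ⊣≐⊢-lower {a} a≤b y z = begin
      y ⊣[ b ] z               ≈⟨ ⊣-congʳ b z (e⊣x≈x y) ⟨
      -- The axiom at the indices `b`, `a` puts `b ↑ a` on the inner operation. Since `a ≤ b` this
      -- index is `b`, so `e` can be absorbed on both sides.
      (e ⊣[ b ] y) ⊣[ b ] z    ≈⟨ subst (λ c → (e ⊣[ c ] y) ⊣[ b ] z ≈ᴹ e ⊣[ b ] (y ⊢[ a ] z))
                                    (↑-absorbʳ a≤b) (⊣-inner-⊢ b a e y z) ⟩
      e ⊣[ b ] (y ⊢[ a ] z)    ≈⟨ e⊣x≈x (y ⊢[ a ] z) ⟩
      y ⊢[ a ] z               ∎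

    ⊣-lower≐⊢ : ∀ {a} → a ≤ b → _⊣[ a ]_ ≐ _⊢[ b ]_
    ⊣-lower≐⊢ {a} a≤b x y = begin
      x ⊣[ a ] y               ≈⟨ x⊢e≈x (x ⊣[ a ] y) ⟨
      -- Here `b ↑ a` sits on the product of `y` with `e`. Its collapse to `b` is what lets `e` act
      -- there as a right unit.
      (x ⊣[ a ] y) ⊢[ b ] e    ≈⟨ subst (λ c → (x ⊣[ a ] y) ⊢[ b ] e ≈ᴹ x ⊢[ b ] (y ⊢[ c ] e))
                                    (↑-absorbʳ a≤b) (⊢-inner-⊣ b a x y e) ⟩
      x ⊢[ b ] (y ⊢[ b ] e)    ≈⟨ ⊢-congˡ b x (x⊢e≈x y) ⟩
      x ⊢[ b ] y               ∎

    -- The case `a = b`, the bridge through which both mixed identities become comparisons of one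
    -- operation at two levels.
    ⊣≐⊢ : _⊣[ b ]_ ≐ _⊢[ b ]_
    ⊣≐⊢ = ⊣≐⊢-lower ≤-refl

    ⊣-lower≐⊣ : ∀ {a} → a ≤ b → _⊣[ a ]_ ≐ _⊣[ b ]_
    ⊣-lower≐⊣ a≤b x y = ≈ᴹ-trans (⊣-lower≐⊢ a≤b x y) (≈ᴹ-sym (⊣≐⊢ x y))

    ⊢-lower≐⊢ : ∀ {a} → a ≤ b → _⊢[ a ]_ ≐ _⊢[ b ]_
    ⊢-lower≐⊢ a≤b x y = ≈ᴹ-trans (≈ᴹ-sym (⊣≐⊢-lower a≤b x y)) (⊣≐⊢ x y)

    wireUnit-lower : ∀ {a} → a ≤ b → IsWireUnitAt a e
    wireUnit-lower a≤b x =
      ≈ᴹ-trans (⊣-lower≐⊣ a≤b e x) (e⊣x≈x x) ,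
      ≈ᴹ-sym (≈ᴹ-trans (⊢-lower≐⊢ a≤b x e) (x⊢e≈x x))

  -- The usual comparison of a left unit with a right unit, except that the two unit laws concern
  -- different operations; `⊣≐⊢` joins them.
  wireUnitAt-unique : ∀ {a e e′} → IsWireUnitAt a e → IsWireUnitAt a e′ → e′ ≈ᴹ e
  wireUnitAt-unique {a} {e} {e′} w w′ = begin
    e′             ≈⟨ proj₁ (w e′) ⟨
    e ⊣[ a ] e′    ≈⟨ ⊣≐⊢ w e e′ ⟩
    e ⊢[ a ] e′    ≈⟨ proj₂ (w′ e) ⟨
    e              ∎

  wireUnit-unique : ∀ {e e′} → IsWireUnit e → IsWireUnit e′ → e′ ≈ᴹ e
  wireUnit-unique (b , w) (a , w′) with ≤-total a b
  ... | inj₁ a≤b = wireUnitAt-unique (wireUnit-lower w a≤b) w′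
  ... | inj₂ b≤a = wireUnitAt-unique w (wireUnit-lower w′ b≤a)

  -- The product `e ⊣[ a ] e′` is `e′` by the wire law of `e`, and `e` by the bar law of `e′`.
  barUnitAt≈wireUnitAt : ∀ {a e e′} → IsWireUnitAt a e → IsBarUnitAt a e′ → e′ ≈ᴹ e
  barUnitAt≈wireUnitAt {a} {e} {e′} wire bar =
    ≈ᴹ-trans (≈ᴹ-sym (proj₁ (wire e′))) (proj₁ (bar e))

proposition3p2p1 : ∀ {k ℓ₁ ℓ₂ m ℓm : Level} (K : HeytingField k ℓ₁ ℓ₂) → CharacteristicZero K →
    (γ : ℕ) (P : PluriassociativeAlgebra K γ m ℓm) →
    let open PluriassociativeAlgebra P in
    (b : Fin γ) (e : Carrierᴹ) → IsWireUnitAt b e →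
    (∀ a → a ≤ b → (_⊣[ a ]_ ≐ _⊣[ b ]_) × (_⊣[ b ]_ ≐ _⊢[ a ]_) × (_⊢[ a ]_ ≐ _⊢[ b ]_))
    × (∀ a → a ≤ b → IsWireUnitAt a e)
    × (IsWireUnit e × (∀ e′ → IsWireUnit e′ → e′ ≈ᴹ e))
    × (∀ a e′ → a ≤ b → IsBarUnitAt a e′ → e′ ≈ᴹ e)
proposition3p2p1 K _ γ P b e wire =
    -- The three links chain all four operations together.
    (λ a a≤b → ⊣-lower≐⊣ P wire a≤b , ⊣≐⊢-lower P wire a≤b , ⊢-lower≐⊢ P wire a≤b)
  , (λ a → wireUnit-lower P wire)
  , ((b , wire) , (λ e′ → wireUnit-unique P (b , wire)))
  -- The wire-unit is brought down to the level of the bar-unit, where the two can be multiplied.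
  , (λ a e′ a≤b → barUnitAt≈wireUnitAt P (wireUnit-lower P wire a≤b))
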